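{- Let $n\geq 3$ be an integer and let $\mathcal{F}$ be the class of all sets of cardinality $\leq n$ (viewed as structures in the empty language). Then $\mathcal{F}$ is a Fraïssé class with no Katětov functor.
   Context: Sets are structures in the empty language, so embeddings are one-to-one mappings and automorphisms are bijections. An embedding of structures is a one-to-one mapping that is an isomorphism onto its image. The age of a structure $M$ is the class of all finitely generated structures embeddable into $M$. A Fraïssé class is a class of finitely generated structures, closed under isomorphism, with countably many isomorphism types, that is hereditary (closed under finitely generated substructures) and has the joint embedding and amalgamation properties (for embeddings). For a Fraïssé class $\mathcal{F}$, let ${}^{\mathrm{emb}}\mathcal{F}$ be the category whose objects are structures from $\mathcal{F}$ and whose arrows are all embeddings between them. Let $\sigma\mathcal{F}$ be the class of all countable (possibly finite) structures whose age is contained in $\mathcal{F}$, and ${}^{\mathrm{emb}}\sigma\mathcal{F}$ the category of all embeddings between structures from $\sigma\mathcal{F}$. A Katětov functor on $\mathcal{F}$ is a functor $K\colon {}^{\mathrm{emb}}\mathcal{F}\to{}^{\mathrm{emb}}\sigma\mathcal{F}$ for which there exists a natural transformation $\eta$ from the identity (the inclusion functor of ${}^{\mathrm{emb}}\mathcal{F}$ into ${}^{\mathrm{emb}}\sigma\mathcal{F}$) to $K$ (so each $\eta_X\colon X\to K(X)$ is an embedding) such that for every $X\in\mathcal{F}$ and every one-point extension $e\colon X\to X'$ there exists an embedding $f\colon X'\to K(X)$ satisfying $\eta_X=f\circ e$. Here a one-point extension of $X$ is an embedding $e\colon X\to X'$ with $X'\in\mathcal{F}$ such that $X'$ is generated by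 $e[X]\cup\{x\}$ for some $x\in X'$. -}

module Defs where

open import Level using (Level; 0ℓ; _⊔_) renaming (suc to lsuc)
open import Data.Empty using (⊥)
open import Data.Nat.Base using (ℕ; _≤_)
open import Data.Fin.Base using (Fin)
open import Data.List.Base using (List)
open import Data.List.Membership.Propositional using (_∈_)
open import Data.Product.Base using (Σ; ∃; ∃-syntax; Σ-syntax; _×_; _,_; proj₁; proj₂)
open import Data.Sum.Base using (_⊎_)
open import Data.Vec.Base using (Vec; map)
open import Data.Vec.Properties using (map-id; map-∘)
open import Data.Vec.Relation.Unary.All using (All)
open import Function.Base using (id; _∘_)
open import Function.Bundles using (_↔_; _↣_; _⇔_; mk⇔; Equivalence)
open import Function.Definitions using (Injective; StrictlySurjective)
open import Relation.Binary.PropositionalEquality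
  using (_≡_; _≗_; refl; sym; trans; cong; subst)
open import Relation.Unary using (Pred; _⊆_)

record Language : Set₁ where
  field
    Fun : ℕ → Set   -- function symbols by arity; constants have arity 0
    Rel : ℕ → Set

-- The carrier may be empty.
record Structure (L : Language) : Set₁ where
  open Language L
  field
    Carrier : Set
    fun     : ∀ {k} → Fun k → Vec Carrier k → Carrier
    rel     : ∀ {k} → Rel k → Vec Carrier k → Set

open Structure public using (Carrier)

module _ {L : Language} where
  open Language L
  open Structure using (fun; rel)

  -- A one-to-one map that is an isomorphism onto its image: relations are
  -- both preserved and reflected.
  record Embedding (M N : Structure L) : Set where
    field
      to        : Carrier M → Carrier N
      injective : Injective _≡_ _≡_ to
      to-fun    : ∀ {k} (f : Fun k) xs → to (fun M f xs) ≡ fun N f (map to xs)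
      to-rel    : ∀ {k} (r : Rel k) xs → rel M r xs ⇔ rel N r (map to xs)

  open Embedding public using (to)

  -- Arrows are compared as maps, ignoring the proof components.
  infix 4 _≈_
  _≈_ : {M N : Structure L} → Embedding M N → Embedding M N → Set
  f ≈ g = to f ≗ to g

  idₑ : {M : Structure L} → Embedding M M
  idₑ {M} = record
    { to        = id
    ; injective = id
    ; to-fun    = λ f xs → cong (fun M f) (sym (map-id xs))
    ; to-rel    = λ r xs → mk⇔ (subst (rel M r) (sym (map-id xs)))
                               (subst (rel M r) (map-id xs))
    }

  infixr 9 _∘ₑ_
  _∘ₑ_ : {M N P : Structure L} → Embedding N P → Embedding M N → Embedding M P
  _∘ₑ_ {M} {N} {P} g f = record
    { to        = to g ∘ to f
    ; injective = λ eq → Embedding.injective f (Embedding.injective g eq)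
    ; to-fun    = λ s xs →
        trans (cong (to g) (Embedding.to-fun f s xs))
       (trans (Embedding.to-fun g s (map (to f) xs))
              (cong (fun P s) (sym (map-∘ (to g) (to f) xs))))
    ; to-rel    = λ r xs →
        let module F = Equivalence (Embedding.to-rel f r xs)
            module G = Equivalence (Embedding.to-rel g r (map (to f) xs))
        in mk⇔ (λ p → subst (rel P r) (sym (map-∘ (to g) (to f) xs)) (G.to (F.to p)))
               (λ q → F.from (G.from (subst (rel P r) (map-∘ (to g) (to f) xs) q)))
    }

  _≅_ : Structure L → Structure L → Set
  M ≅ N = Σ[ e ∈ Embedding M N ] StrictlySurjective _≡_ (to e)

  -- The substructure of M generated by the subset S.
  data Generated {ℓ} (M : Structure L) (S : Pred (Carrier M) ℓ) : Pred (Carrier M) ℓ where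
    gen : ∀ {x} → S x → Generated M S x
    app : ∀ {k} (f : Fun k) {xs : Vec (Carrier M) k} →
          All (Generated M S) xs → Generated M S (fun M f xs)

  FinitelyGenerated : Structure L → Set
  FinitelyGenerated M = Σ[ xs ∈ List (Carrier M) ] (∀ y → Generated M (_∈ xs) y)

  Age : Structure L → Pred (Structure L) 0ℓ
  Age M X = FinitelyGenerated X × Embedding X M

  Countable : Structure L → Set
  Countable M = Carrier M ↣ ℕ

  module _ {ℓ : Level} (F : Pred (Structure L) ℓ) where

    -- Substructures are represented by embeddings, so `hereditary` is closure
    -- under finitely generated structures embeddable in a member.
    record IsFraisseClass : Set (lsuc 0ℓ ⊔ ℓ) where
      field
        finitelyGenerated : ∀ {M} → F M → FinitelyGenerated M
        isoClosed         : ∀ {M N} → M ≅ N → F M → F N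
        countablyMany     : Σ[ enum ∈ (ℕ → Structure L) ]
                              (∀ {M} → F M → ∃[ i ] M ≅ enum i)
        hereditary        : ∀ {M N} → F M → FinitelyGenerated N → Embedding N M → F N
        jointEmbedding    : ∀ {M N} → F M → F N →
                            Σ[ P ∈ Structure L ] F P × Embedding M P × Embedding N P
        amalgamation      : ∀ {Z M N} → F Z → F M → F N →
                            (f : Embedding Z M) (g : Embedding Z N) →
                            Σ[ W ∈ Structure L ] F W ×
                            (Σ[ f′ ∈ Embedding M W ] Σ[ g′ ∈ Embedding N W ]
                              (f′ ∘ₑ f) ≈ (g′ ∘ₑ g))

    σ : Pred (Structure L) (lsuc 0ℓ ⊔ ℓ)
    σ M = Countable M × (Age M ⊆ F)

    IsOnePointExtension : {X X′ : Structure L} → Embedding X X′ → Set ℓ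
    IsOnePointExtension {X} {X′} e =
      F X′ ×
      (∃[ x ] (∀ y → Generated X′ (λ z → (∃[ a ] to e a ≡ z) ⊎ z ≡ x) y))

  -- Functors from the category of all embeddings between members of C to the
  -- category of all embeddings between members of D.
  record EmbFunctor {c d} (C : Pred (Structure L) c) (D : Pred (Structure L) d)
         : Set (lsuc 0ℓ ⊔ c ⊔ d) where
    field
      obj   : ∃ C → ∃ D
      arr   : (X Y : ∃ C) → Embedding (proj₁ X) (proj₁ Y) →
              Embedding (proj₁ (obj X)) (proj₁ (obj Y))
      arr-≈ : ∀ X Y {f g} → f ≈ g → arr X Y f ≈ arr X Y g
      arr-id : ∀ X → arr X X idₑ ≈ idₑ
      arr-∘ : ∀ X Y Z (g : Embedding (proj₁ Y) (proj₁ Z)) (f : Embedding (proj₁ X) (proj₁ Y)) →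
              arr X Z (g ∘ₑ f) ≈ (arr Y Z g ∘ₑ arr X Y f)

    ⟦_⟧ : ∃ C → Structure L
    ⟦ X ⟧ = proj₁ (obj X)

  record IsKatetov {ℓ} (F : Pred (Structure L) ℓ) (K : EmbFunctor F (σ F))
         : Set (lsuc 0ℓ ⊔ ℓ) where
    open EmbFunctor K
    field
      η       : (X : ∃ F) → Embedding (proj₁ X) ⟦ X ⟧
      natural : ∀ X Y (f : Embedding (proj₁ X) (proj₁ Y)) →
                (η Y ∘ₑ f) ≈ (arr X Y f ∘ₑ η X)
      extends : ∀ X {X′} (e : Embedding (proj₁ X) X′) → IsOnePointExtension F e →
                Σ[ f ∈ Embedding X′ ⟦ X ⟧ ] η X ≈ (f ∘ₑ e)

  KatetovFunctor : ∀ {ℓ} → Pred (Structure L) ℓ → Set (lsuc 0ℓ ⊔ ℓ)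
  KatetovFunctor F = Σ[ K ∈ EmbFunctor F (σ F) ] IsKatetov F K

emptyLanguage : Language
emptyLanguage = record { Fun = λ _ → ⊥ ; Rel = λ _ → ⊥ }

SetsOfCard≤ : ℕ → Pred (Structure emptyLanguage) 0ℓ
SetsOfCard≤ n X = ∃[ m ] m ≤ n × (Carrier X ↔ Fin m)

{-# OPTIONS --safe #-}

-- The failure of a Katětov functor K is already visible on the inclusion of
-- the empty set into Z = Fin n.  Since ∅ has a one-point extension, K ∅ has an
-- element p; let q be its image in K Z.  Every permutation s of Z fixes the
-- inclusion ∅ → Z, so K s fixes q.  On the other hand K Z has at most n
-- elements, so q = η z for some z, and K s q = η (s z) by naturality.  Hence
-- every s fixes z, which is absurd for 2 ≤ n.
module Submission where

open import Defs
open import Data.Nat using (ℕ; zero; suc; _≤_; z≤n; s≤s)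
open import Data.Nat.Properties using (≤-refl; <⇒≤; <⇒≱)
open import Data.Fin using (Fin; zero; suc; inject≤; punchIn)
open import Data.Fin.Permutation using (Permutation; transpose; _⟨$⟩ʳ_)
open import Data.Fin.Properties
  using (_≟_; inj⇒≟; injective⇒≤; inject≤-injective; suc-injective; punchInᵢ≢i)
open import Data.List using (List; length; lookup; map; allFin)
open import Data.List.Membership.Propositional using (_∈_)
open import Data.List.Membership.Propositional.Properties
  using (∈-map⁺; ∈-allFin; ∈-lookup; ∈-deduplicate⁺)
open import Data.List.Relation.Unary.All as All using ()
open import Data.List.Relation.Unary.AllPairs using (_∷_)
open import Data.List.Relation.Unary.Any using (index)
open import Data.List.Relation.Unary.Any.Properties using (lookup-index)
open import Data.List.Relation.Unary.Unique.Propositional using (Unique)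
open import Data.List.Relation.Unary.Unique.DecPropositional.Properties using (deduplicate-!)
open import Data.Product using (_×_; _,_; Σ-syntax; ∃; ∃-syntax; proj₁; proj₂)
open import Data.Sum using (inj₂)
open import Function using (_∘_; _↔_; _↣_; Injection; Inverse; Injective; mk↣; mk⤖; mk↔ₛ′)
open import Function.Construct.Composition using (_↔-∘_; _↣-∘_)
open import Function.Construct.Identity using (↔-id)
open import Function.Construct.Symmetry using (↔-sym)
open import Function.Consequences.Propositional using (strictlySurjective⇒surjective)
open import Function.Properties.Bijection using (⤖⇒↔)
open import Function.Properties.Inverse using (↔⇒↣)
open import Relation.Binary using (DecidableEquality)
open import Relation.Binary.PropositionalEquality
  using (_≡_; _≢_; refl; sym; trans; cong; subst; module ≡-Reasoning)
open import Relation.Nullary using (¬_; contradiction)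
open import Relation.Nullary.Decidable using (dec-true; dec-false)

private
  variable
    k m n : ℕ
    A : Set

lookup-injective : {xs : List A} → Unique xs → Injective _≡_ _≡_ (lookup xs)
lookup-injective (_ ∷ _)   {zero}  {zero}  _  = refl
lookup-injective (x∉ ∷ _)  {zero}  {suc j} eq = contradiction eq (All.lookup x∉ (∈-lookup j))
lookup-injective (x∉ ∷ _)  {suc i} {zero}  eq = contradiction (sym eq) (All.lookup x∉ (∈-lookup i))
lookup-injective (_ ∷ xs!) {suc i} {suc j} eq = cong suc (lookup-injective xs! eq)

unique-enumeration⇒↔ : {xs : List A} → Unique xs → (∀ x → x ∈ xs) → A ↔ Fin (length xs)
unique-enumeration⇒↔ {xs = xs} xs! all = mk↔ₛ′ (index ∘ all) (lookup xs)
  (λ i → lookup-injective xs! (sym (lookup-index (all (lookup xs i)))))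
  (λ x → sym (lookup-index (all x)))

-- A finite generating list may repeat elements; once repetitions are removed, every element has
-- exactly one position. Decidable equality is what permits the removal.
enumerated⇒↔ : DecidableEquality A → (xs : List A) → (∀ x → x ∈ xs) → ∃[ k ] A ↔ Fin k
enumerated⇒↔ _≟′_ xs all =
  _ , unique-enumeration⇒↔ (deduplicate-! _≟′_ xs) (∈-deduplicate⁺ _≟′_ ∘ all)

Fin-↣⇒≤ : Fin m ↣ Fin n → m ≤ n
Fin-↣⇒≤ f = injective⇒≤ (Injection.injective f)

inject≤-↣ : m ≤ n → Fin m ↣ Fin n
inject≤-↣ m≤n = mk↣ (inject≤-injective m≤n m≤n _ _)

transpose-source : (i j : Fin n) → transpose i j ⟨$⟩ʳ i ≡ j
transpose-source i j rewrite dec-true (i ≟ i) refl = refl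

transpose-other : (i j : Fin n) {l : Fin n} → l ≢ i → l ≢ j → transpose i j ⟨$⟩ʳ l ≡ l
transpose-other i j {l} l≢i l≢j
  rewrite dec-false (l ≟ i) l≢i | dec-false (l ≟ j) l≢j = refl

-- Induction on k: an extension that is correct on the image of all but one
-- point is corrected at the remaining one by a transposition of the target.
extend-↣ : m ≤ n → (g : Fin k ↣ Fin m) (h : Fin k ↣ Fin n) →
           Σ[ g′ ∈ Fin m ↣ Fin n ] (∀ i → Injection.to g′ (Injection.to g i) ≡ Injection.to h i)
extend-↣ {k = zero}  m≤n g h = inject≤-↣ m≤n , λ ()
extend-↣ {k = suc k} m≤n g h = ↔⇒↣ τ ↣-∘ e , commutes
  where
  module G = Injection g
  module H = Injection h
  suc-↣ : Fin k ↣ Fin (suc k)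
  suc-↣ = mk↣ suc-injective
  rec = extend-↣ m≤n (g ↣-∘ suc-↣) (h ↣-∘ suc-↣)
  e = proj₁ rec
  module E = Injection e
  e-eq = proj₂ rec
  τ = transpose (E.to (G.to zero)) (H.to zero)

  commutes : ∀ i → τ ⟨$⟩ʳ E.to (G.to i) ≡ H.to i
  commutes zero    = transpose-source (E.to (G.to zero)) (H.to zero)
  -- Injectivity of `g` and `e`, and then of `h`, keeps the values already correct away from both
  -- swapped points, so `τ` leaves them alone.
  commutes (suc i) = trans
    (transpose-other (E.to (G.to zero)) (H.to zero)
      (λ eq → contradiction (G.injective (E.injective eq)) λ ())
      (λ eq → contradiction (H.injective (trans (sym (e-eq i)) eq)) λ ()))
    (e-eq i)

⟪_⟫ : Set → Structure emptyLanguage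
⟪ A ⟫ = record { Carrier = A ; fun = λ () ; rel = λ () }

module _ {M N : Structure emptyLanguage} where

  ↣⇒embedding : Carrier M ↣ Carrier N → Embedding M N
  ↣⇒embedding f = record
    { to = Injection.to f ; injective = Injection.injective f ; to-fun = λ () ; to-rel = λ () }

  embedding⇒↣ : Embedding M N → Carrier M ↣ Carrier N
  embedding⇒↣ e = mk↣ (Embedding.injective e)

  ↔⇒≅ : Carrier M ↔ Carrier N → M ≅ N
  ↔⇒≅ f = ↣⇒embedding (↔⇒↣ f) , λ y → Inverse.from f y , Inverse.strictlyInverseˡ f y

  ≅⇒↔ : M ≅ N → Carrier M ↔ Carrier N
  ≅⇒↔ (e , surj) = ⤖⇒↔ (mk⤖ (Embedding.injective e , strictlySurjective⇒surjective surj))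

-- There are no function symbols, so only `gen` can occur; thus finitely generated means finite.
generated⇒∈ : {M : Structure emptyLanguage} {S : Carrier M → Set} {x : Carrier M} →
              Generated M S x → S x
generated⇒∈ (gen p) = p

↔Fin⇒finitelyGenerated : {M : Structure emptyLanguage} → Carrier M ↔ Fin m → FinitelyGenerated M
↔Fin⇒finitelyGenerated {m} f = map F.from (allFin m) ,
  λ y → gen (subst (_∈ _) (F.strictlyInverseʳ y) (∈-map⁺ F.from (∈-allFin (F.to y))))
  where module F = Inverse f

Fin-member : m ≤ n → SetsOfCard≤ n ⟪ Fin m ⟫
Fin-member m≤n = _ , m≤n , ↔-id _

isFraisseClass : ∀ n → IsFraisseClass (SetsOfCard≤ n)
isFraisseClass n = record
  { finitelyGenerated = λ (_ , _ , f) → ↔Fin⇒finitelyGenerated f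
  ; isoClosed         = λ M≅N (m , m≤n , f) → m , m≤n , f ↔-∘ ↔-sym (≅⇒↔ M≅N)
  ; countablyMany     = (λ m → ⟪ Fin m ⟫) , λ (m , _ , f) → m , ↔⇒≅ f
  ; hereditary        = hereditary
  ; jointEmbedding    = λ FM FN → ⟪ Fin n ⟫ , Fin-member ≤-refl ,
                          ↣⇒embedding (member-↣ FM) , ↣⇒embedding (member-↣ FN)
  ; amalgamation      = amalgamation
  }
  where
  -- This makes the n-element set a common target for both joint embedding and amalgamation.
  member-↣ : (∃[ m ] m ≤ n × (A ↔ Fin m)) → A ↣ Fin n
  member-↣ (_ , m≤n , f) = inject≤-↣ m≤n ↣-∘ ↔⇒↣ f

  hereditary : ∀ {M N} → SetsOfCard≤ n M → FinitelyGenerated N → Embedding N M → SetsOfCard≤ n N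
  hereditary {N = N} FM (xs , generates) e =
    _ , Fin-↣⇒≤ (N↣Fin ↣-∘ ↔⇒↣ (↔-sym N↔Fin)) , N↔Fin
    where
    N↣Fin : Carrier N ↣ Fin n
    N↣Fin = member-↣ FM ↣-∘ embedding⇒↣ e
    -- Equality on `N` is decided by comparing images in `Fin n`.
    N↔Fin = proj₂ (enumerated⇒↔ (inj⇒≟ N↣Fin) xs (generated⇒∈ ∘ generates))

  -- Gluing freely along `Z` could produce more than n points. Instead `M` is placed in `Fin n`
  -- first, and the map this prescribes on the image of `Z` in `N` is extended to all of `N`.
  amalgamation : ∀ {Z M N} → SetsOfCard≤ n Z → SetsOfCard≤ n M → SetsOfCard≤ n N →
                 (f : Embedding Z M) (g : Embedding Z N) →
                 Σ[ W ∈ Structure emptyLanguage ] SetsOfCard≤ n W ×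
                 (Σ[ f′ ∈ Embedding M W ] Σ[ g′ ∈ Embedding N W ] (f′ ∘ₑ f) ≈ (g′ ∘ₑ g))
  amalgamation {Z} {M} {N} (_ , _ , z) FM (_ , m≤n , b) f g =
    ⟪ Fin n ⟫ , Fin-member ≤-refl , ↣⇒embedding f′ , ↣⇒embedding (g″ ↣-∘ ↔⇒↣ b) , commutes
    where
    f′ = member-↣ FM
    -- `Z` is replaced by its index set because `extend-↣` inducts on its size.
    z⁻¹ = ↔⇒↣ (↔-sym z)
    extension = extend-↣ m≤n (↔⇒↣ b ↣-∘ (embedding⇒↣ g ↣-∘ z⁻¹)) (f′ ↣-∘ (embedding⇒↣ f ↣-∘ z⁻¹))
    g″ = proj₁ extension

    commutes : ∀ x → Injection.to f′ (to f x) ≡ Injection.to g″ (Inverse.to b (to g x))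
    commutes x = subst
      (λ y → Injection.to f′ (to f y) ≡ Injection.to g″ (Inverse.to b (to g y)))
      (Inverse.strictlyInverseʳ z x)
      (sym (proj₂ extension (Inverse.to z x)))

-- Such an injection would put a set of n + 1 points in the age, hence in the class.
σ-bounded : {M : Structure emptyLanguage} → σ (SetsOfCard≤ n) M → ¬ (Fin (suc n) ↣ Carrier M)
σ-bounded {n} (_ , age) f
  with m , m≤n , g ← age {⟪ Fin (suc n) ⟫} (↔Fin⇒finitelyGenerated (↔-id _) , ↣⇒embedding f)
  = <⇒≱ (Fin-↣⇒≤ (↔⇒↣ g)) m≤n

∷-↣ : (f : Fin n ↣ A) (x : A) → (∀ i → Injection.to f i ≢ x) → Fin (suc n) ↣ A
∷-↣ {n} {A} f x x∉ = mk↣ {to = h} h-injective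
  where
  h : Fin (suc n) → A
  h zero    = x
  h (suc i) = Injection.to f i
  h-injective : Injective _≡_ _≡_ h
  h-injective {zero}  {zero}  _  = refl
  h-injective {zero}  {suc j} eq = contradiction (sym eq) (x∉ j)
  h-injective {suc i} {zero}  eq = contradiction eq (x∉ i)
  h-injective {suc i} {suc j} eq = cong suc (Injection.injective f eq)

movable : 2 ≤ n → (z : Fin n) → Σ[ π ∈ Permutation n n ] π ⟨$⟩ʳ z ≢ z
movable (s≤s (s≤s _)) z =
  transpose z w , λ eq → punchInᵢ≢i z zero (trans (sym (transpose-source z w)) eq)
  -- As 2 ≤ n, there is a point other than `z`; `punchIn z` skips exactly `z`.
  where w = punchIn z zero

noKatetovFunctor : 2 ≤ n → ¬ KatetovFunctor (SetsOfCard≤ n)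
noKatetovFunctor {n} 2≤n (K , isKatetov) =
  -- The image of `η Z` already has n points, so `q` outside it would be one too many.
  σ-bounded (proj₂ (obj Z)) (∷-↣ (embedding⇒↣ (η Z)) q q∉η)
  where
  open EmbFunctor K
  open IsKatetov isKatetov

  ∅ Z : ∃ (SetsOfCard≤ n)
  ∅ = ⟪ Fin 0 ⟫ , Fin-member z≤n
  Z = ⟪ Fin n ⟫ , Fin-member ≤-refl

  absurd : ∀ {M} → Embedding (proj₁ ∅) M
  absurd = ↣⇒embedding (mk↣ {to = λ ()} λ { {()} })

  point : Carrier ⟦ ∅ ⟧
  -- The one-element set is generated by its own point over the empty set, and 1 ≤ n places it in
  -- the class.
  point = to (proj₁ (extends ∅ {⟪ Fin 1 ⟫} absurd
    (Fin-member (<⇒≤ 2≤n) , zero , λ where zero → gen (inj₂ refl)))) zero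

  q : Carrier ⟦ Z ⟧
  q = to (arr ∅ Z absurd) point

  q-fixed : (s : Embedding (proj₁ Z) (proj₁ Z)) → to (arr Z Z s) q ≡ q
  -- `s ∘ₑ absurd` and `absurd` agree vacuously, so `arr-≈` identifies their images under the
  -- functor.
  q-fixed s = trans (sym (arr-∘ ∅ Z Z s absurd point)) (arr-≈ ∅ Z (λ ()) point)

  q∉η : ∀ z → to (η Z) z ≢ q
  q∉η z ηz≡q with π , πz≢z ← movable 2≤n z = πz≢z (Embedding.injective (η Z) (begin
    to (η Z) (π ⟨$⟩ʳ z)         ≡⟨ natural Z Z s z ⟩
    to (arr Z Z s) (to (η Z) z) ≡⟨ cong (to (arr Z Z s)) ηz≡q ⟩
    to (arr Z Z s) q            ≡⟨ q-fixed s ⟩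
    q                           ≡⟨ ηz≡q ⟨
    to (η Z) z                  ∎))
    where
    open ≡-Reasoning
    s : Embedding (proj₁ Z) (proj₁ Z)
    s = ↣⇒embedding (↔⇒↣ π)

corollary1p3 : (n : ℕ) → 3 ≤ n →
    IsFraisseClass (SetsOfCard≤ n) × ¬ KatetovFunctor (SetsOfCard≤ n)
corollary1p3 n 3≤n = isFraisseClass n , noKatetovFunctor (<⇒≤ 3≤n)
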